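{- $\mathrm{FO}$ and $\mathrm{GRA}=\mathrm{GRA}(e,p,s,I,\neg,J,\exists)$ are equiexpressive; that is, every term of $\mathrm{GRA}(e,p,s,I,\neg,J,\exists)$ has an equivalent $\mathrm{FO}$-formula, and every $\mathrm{FO}$-formula has an equivalent term of $\mathrm{GRA}(e,p,s,I,\neg,J,\exists)$.
   Context: AD-relations. $A^0=\{\epsilon\}$, with $\epsilon$ the empty tuple. A $k$-ary AD-relation over a set $A$ is a pair $(R,k)$ with $R\subseteq A^k$, $k\ge 0$; $t\in(R,k)$ means $t\in R$. Vocabularies contain only relation symbols (of any arity $k\ge 0$, countably infinitely many available for each arity). Models have nonempty domains; $A$ is the domain of $\mathfrak{A}$. Terms. $\mathrm{GRA}(e,p,s,I,\neg,J,\exists)$ is the set of terms built from relation symbols and the constant $e$ by the unary operators $p,s,I,\neg,\exists$ and the binary operator $J$. Each term $\mathcal{T}$ defines in each model $\mathfrak{A}$ an AD-relation $\mathcal{T}^{\mathfrak{A}}$ of arity $\mathit{ar}(\mathcal{T})$. Let $k=\mathit{ar}(\mathcal{T})$, $\ell=\mathit{ar}(\mathcal{S})$. - $R^{\mathfrak{A}}$ is the interpretation of $R$, paired with the arity of $R$; $e^{\mathfrak{A}}=(\{(a,a)\mid a\in A\},2)$. - If $k\ge2$: $(p\mathcal{T})^{\mathfrak{A}}=(\{(a_k,a_1,\dots,a_{k-1})\mid(a_1,\dots,a_k)\in\mathcal{T}^{\mathfrak{A}}\},k)$; $(s\mathcal{T})^{\mathfrak{A}}=(\{(a_1,\dots,a_{k-2},a_k,a_{k-1})\mid(a_1,\dots,a_k)\in\mathcal{T}^{\mathfrak{A}}\},k)$;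 $(I\mathcal{T})^{\mathfrak{A}}=(\{(a_1,\dots,a_{k-1})\mid(a_1,\dots,a_k)\in\mathcal{T}^{\mathfrak{A}},\ a_{k-1}=a_k\},k-1)$. If $k\le1$, each of $p\mathcal{T},s\mathcal{T},I\mathcal{T}$ is interpreted as $\mathcal{T}^{\mathfrak{A}}$. - $(\neg\mathcal{T})^{\mathfrak{A}}=(\{t\in A^k\mid t\notin\mathcal{T}^{\mathfrak{A}}\},k)$. - $(J(\mathcal{T},\mathcal{S}))^{\mathfrak{A}}=(\{(a_1,\dots,a_k,b_1,\dots,b_\ell)\mid(a_1,\dots,a_k)\in\mathcal{T}^{\mathfrak{A}},(b_1,\dots,b_\ell)\in\mathcal{S}^{\mathfrak{A}}\},k+\ell)$. - If $k\ge1$: $(\exists\mathcal{T})^{\mathfrak{A}}=(\{(a_1,\dots,a_{k-1})\mid(a_1,\dots,a_k)\in\mathcal{T}^{\mathfrak{A}}\text{ for some }a_k\in A\},k-1)$; if $k=0$: $(\exists\mathcal{T})^{\mathfrak{A}}=\mathcal{T}^{\mathfrak{A}}$. Formulas. $\mathrm{FO}$ is first-order logic with equality over relation symbols, with variables $v_1,v_2,\dots$. A formula $\varphi$ whose free variables are exactly $v_{i_1},\dots,v_{i_k}$ with $i_1<\dots<i_k$ defines $\varphi^{\mathfrak{A}}=(\{(a_1,\dots,a_k)\in A^k\mid\mathfrak{A}\models\varphi(a_1,\dots,a_k)\},k)$, where $a_j$ is assigned to $v_{i_j}$. A formula $\varphi$ and a term $\mathcal{T}$ are equivalent if $\varphi^{\mathfrak{A}}=\mathcal{T}^{\mathfrak{A}}$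 for every model $\mathfrak{A}$ whose vocabulary contains all symbols of $\varphi$ and $\mathcal{T}$. -}

module Defs where

open import Data.List.Base using (List; []; _∷_; _++_; filter; foldr; length; upTo)
open import Data.List.Membership.DecPropositional using (_∈?_)
open import Data.Nat.Base using (ℕ; zero; suc; _+_; _⊔_; pred)
open import Data.Nat.Properties using (_≟_)
open import Data.Product.Base using (Σ-syntax; ∃; ∃₂; ∃-syntax; _×_; _,_)
open import Data.Sum.Base using (inj₁; inj₂)
open import Data.Vec.Base as Vec using (Vec; []; _∷_; _∷ʳ_)
open import Function.Bundles using (_⇔_)
open import Level using (Level; 0ℓ) renaming (suc to lsuc)
open import Relation.Binary.PropositionalEquality.Core using (_≡_; refl)
open import Relation.Nullary using (¬_; yes; no)
open import Relation.Nullary.Decidable using (¬?)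
open import Relation.Unary using (Pred; ∅; _∪_; ｛_｝; _⊆_; ∁)

private
  variable
    ℓ   : Level
    A   : Set ℓ
    k l : ℕ

------------------------------------------------------------------------
-- AD-relations

Rel : Set ℓ → ℕ → Set (lsuc ℓ)
Rel {ℓ} A k = Pred (Vec A k) ℓ

record ADRel (A : Set ℓ) : Set (lsuc ℓ) where
  constructor _,ᴬᴰ_
  field
    arity  : ℕ
    tuples : Rel A arity

-- Equality of AD-relations: equal arities and the same tuples.  The
-- sets of tuples are compared extensionally; the cast only transports
-- a tuple along the equality of the arities.
infix 4 _≈_
_≈_ : {A : Set ℓ} → ADRel A → ADRel A → Set ℓ
(k ,ᴬᴰ R) ≈ (l ,ᴬᴰ S) = Σ[ eq ∈ k ≡ l ] (∀ t → R t ⇔ S (Vec.cast eq t))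

------------------------------------------------------------------------
-- Relation symbols and models

-- For every arity there is one symbol for each natural number.
record Symbol : Set where
  constructor symbol
  field
    arity : ℕ
    index : ℕ

-- Membership of a symbol in the vocabulary is used irrelevantly, so that
-- its interpretation does not depend on the proof of membership.
record Model (ℓ : Level) : Set (lsuc ℓ) where
  field
    vocabulary : Pred Symbol ℓ
    Domain     : Set ℓ
    element    : Domain
    interp     : ∀ R → .(vocabulary R) → Rel Domain (Symbol.arity R)

------------------------------------------------------------------------
-- Terms of GRA(e,p,s,I,¬,J,∃)

data Term : Set where
  rel : Symbol → Term
  e   : Term
  p   : Term → Term
  s   : Term → Term
  I   : Term → Term
  ¬ᵗ  : Term → Term
  J   : Term → Term → Term
  ∃ᵗ  : Term → Term

arᴵ : ℕ → ℕ
arᴵ (suc (suc n)) = suc n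
arᴵ k             = k

ar : Term → ℕ
ar (rel R) = Symbol.arity R
ar e       = 2
ar (p T)   = ar T
ar (s T)   = ar T
ar (I T)   = arᴵ (ar T)
ar (¬ᵗ T)  = ar T
ar (J T S) = ar T + ar S
ar (∃ᵗ T)  = pred (ar T)

symbolsᵗ : Term → Pred Symbol 0ℓ
symbolsᵗ (rel R) = ｛ R ｝
symbolsᵗ e       = ∅
symbolsᵗ (p T)   = symbolsᵗ T
symbolsᵗ (s T)   = symbolsᵗ T
symbolsᵗ (I T)   = symbolsᵗ T
symbolsᵗ (¬ᵗ T)  = symbolsᵗ T
symbolsᵗ (J T S) = symbolsᵗ T ∪ symbolsᵗ S
symbolsᵗ (∃ᵗ T)  = symbolsᵗ T

eᴿ : Rel A 2
eᴿ t = ∃[ a ] t ≡ a ∷ a ∷ []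

pᴿ : Rel A k → Rel A k
pᴿ {k = suc (suc n)} R t =
  ∃₂ λ as a → R (as ∷ʳ a) × t ≡ a ∷ as
pᴿ {k = suc zero}    R   = R
pᴿ {k = zero}        R   = R

sᴿ : Rel A k → Rel A k
sᴿ {k = suc (suc n)} R t =
  ∃[ as ] ∃₂ λ a b → R (as ∷ʳ a ∷ʳ b) × t ≡ as ∷ʳ b ∷ʳ a
sᴿ {k = suc zero}    R   = R
sᴿ {k = zero}        R   = R

Iᴿ : Rel A k → Rel A (arᴵ k)
Iᴿ {k = suc (suc n)} R t =
  ∃[ as ] ∃₂ λ a b → R (as ∷ʳ a ∷ʳ b) × a ≡ b × t ≡ as ∷ʳ a
Iᴿ {k = suc zero}    R   = R
Iᴿ {k = zero}        R   = R

Jᴿ : Rel A k → Rel A l → Rel A (k + l)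
Jᴿ R S t = ∃₂ λ as bs → R as × S bs × t ≡ as Vec.++ bs

∃ᴿ : Rel A k → Rel A (pred k)
∃ᴿ {k = suc n} R t = ∃[ a ] R (t ∷ʳ a)
∃ᴿ {k = zero}  R   = R

module _ (𝔄 : Model ℓ) where
  open Model 𝔄

  ⟦_⟧ᵗ : ∀ T → .(symbolsᵗ T ⊆ vocabulary) → Rel Domain (ar T)
  ⟦ rel R ⟧ᵗ h = interp R (h refl)
  ⟦ e     ⟧ᵗ h = eᴿ
  ⟦ p T   ⟧ᵗ h = pᴿ (⟦ T ⟧ᵗ h)
  ⟦ s T   ⟧ᵗ h = sᴿ (⟦ T ⟧ᵗ h)
  ⟦ I T   ⟧ᵗ h = Iᴿ (⟦ T ⟧ᵗ h)
  ⟦ ¬ᵗ T  ⟧ᵗ h = ∁ (⟦ T ⟧ᵗ h)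
  ⟦ J T S ⟧ᵗ h = Jᴿ (⟦ T ⟧ᵗ (λ x → h (inj₁ x))) (⟦ S ⟧ᵗ (λ x → h (inj₂ x)))
  ⟦ ∃ᵗ T  ⟧ᵗ h = ∃ᴿ (⟦ T ⟧ᵗ h)

  termRel : ∀ T → .(symbolsᵗ T ⊆ vocabulary) → ADRel Domain
  termRel T h = ar T ,ᴬᴰ ⟦ T ⟧ᵗ h

------------------------------------------------------------------------
-- First-order formulas

-- The number i stands for the variable v_{i+1}.
Var : Set
Var = ℕ

-- The primitives are ¬, ∧, ∃ and equality; ∨, →, ∀ are the usual
-- (classical) abbreviations.
data Formula : Set where
  rel  : (R : Symbol) → Vec Var (Symbol.arity R) → Formula
  _≐_  : Var → Var → Formula
  ¬ᶠ   : Formula → Formula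
  _∧ᶠ_ : Formula → Formula → Formula
  ∃ᶠ   : Var → Formula → Formula

symbolsᶠ : Formula → Pred Symbol 0ℓ
symbolsᶠ (rel R xs) = ｛ R ｝
symbolsᶠ (x ≐ y)    = ∅
symbolsᶠ (¬ᶠ φ)     = symbolsᶠ φ
symbolsᶠ (φ ∧ᶠ ψ)   = symbolsᶠ φ ∪ symbolsᶠ ψ
symbolsᶠ (∃ᶠ x φ)   = symbolsᶠ φ

-- The free occurrences, in no particular order and with repetitions.
fv : Formula → List Var
fv (rel R xs) = Vec.toList xs
fv (x ≐ y)    = x ∷ y ∷ []
fv (¬ᶠ φ)     = fv φ
fv (φ ∧ᶠ ψ)   = fv φ ++ fv ψ
fv (∃ᶠ x φ)   = filter (λ y → ¬? (y ≟ x)) (fv φ)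

-- The free variables in strictly increasing order: the bound exceeds
-- every element of fv φ, and upTo n lists 0, …, n - 1.
freeVars : Formula → List Var
freeVars φ = filter (λ x → _∈?_ _≟_ x (fv φ)) (upTo bound)
  where
  bound : ℕ
  bound = foldr (λ x n → suc x ⊔ n) 0 (fv φ)

infixl 10 _[_↦_]
_[_↦_] : (Var → A) → Var → A → (Var → A)
(σ [ x ↦ a ]) y with y ≟ x
... | yes _ = a
... | no  _ = σ y

module _ (𝔄 : Model ℓ) where
  open Model 𝔄

  Sat : ∀ φ → .(symbolsᶠ φ ⊆ vocabulary) → Pred (Var → Domain) ℓ
  Sat (rel R xs) h σ = interp R (h refl) (Vec.map σ xs)
  Sat (x ≐ y)    h σ = σ x ≡ σ y
  Sat (¬ᶠ φ)     h σ = ¬ Sat φ h σ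
  Sat (φ ∧ᶠ ψ)   h σ = Sat φ (λ x → h (inj₁ x)) σ × Sat ψ (λ x → h (inj₂ x)) σ
  Sat (∃ᶠ x φ)   h σ = ∃[ a ] Sat φ h (σ [ x ↦ a ])

  -- The j-th entry of the tuple goes to the j-th listed variable; the
  -- remaining variables get an arbitrary value, which is irrelevant to
  -- the formulas having all their free variables in the list.
  assign : (xs : List Var) → Vec Domain (length xs) → (Var → Domain)
  assign []       []       = λ _ → element
  assign (x ∷ xs) (a ∷ as) = assign xs as [ x ↦ a ]

  formulaRel : ∀ φ → .(symbolsᶠ φ ⊆ vocabulary) → ADRel Domain
  formulaRel φ h =
    length (freeVars φ) ,ᴬᴰ λ t → Sat φ h (assign (freeVars φ) t)

------------------------------------------------------------------------
-- Equivalence of formulas and terms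

Equivalent : (ℓ : Level) → Formula → Term → Set (lsuc ℓ)
Equivalent ℓ φ T =
  (𝔄 : Model ℓ) →
  (hφ : symbolsᶠ φ ⊆ Model.vocabulary 𝔄) →
  (hT : symbolsᵗ T ⊆ Model.vocabulary 𝔄) →
  formulaRel 𝔄 φ hφ ≈ termRel 𝔄 T hT

{-# OPTIONS --safe #-}
module Submission where

-- Terms and formulas are both evaluated at assignments σ : ℕ → Domain, a term of
-- arity k reading σ 0, …, σ (k - 1).  Then p, s and I are mere renamings of σ, so
-- a term is turned into a formula by carrying a renaming through the recursion;
-- adding trivial equations i ≐ i makes exactly the first k variables free.
--
-- Conversely, every substitution instance { t | t ∘ g ∈ T } of a term T is again
-- definable: join T with Aⁿ on the left, and then, from the last column on,
-- equate each column of T with its column in Aⁿ and drop it.  Rotations by p and s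
-- bring the two columns next to each other, where I applies.  Atoms and
-- conjunctions are such instances, and ∃ quantifies the last column.

open import Data.Fin.Base using (toℕ)
open import Data.Fin.Properties using (toℕ<n)
open import Data.List.Base using (List; []; _∷_; applyUpTo; filter; foldr; length; upTo)
open import Data.List.Membership.DecPropositional using (_∈?_)
open import Data.List.Membership.Propositional using (_∈_)
open import Data.List.Membership.Propositional.Properties
  using (∈-++⁺ˡ; ∈-++⁺ʳ; ∈-++⁻; ∈-filter⁺; ∈-filter⁻; ∈-upTo⁺; ∈-upTo⁻)
open import Data.List.Properties using (filter-all; length-upTo)
open import Data.List.Relation.Unary.All as All using ()
open import Data.List.Relation.Unary.Any using (here; there)
open import Data.Nat.Base
open import Data.Nat.GeneralisedArithmetic using (fold; fold-+)
open import Data.Nat.Properties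
open import Data.Product.Base using (Σ-syntax; ∃-syntax; _×_; _,_; proj₁; proj₂)
open import Data.Product.Function.Dependent.Propositional using (Σ-⇔)
open import Data.Product.Function.NonDependent.Propositional using (_×-⇔_)
open import Data.Sum.Base using (_⊎_; inj₁; inj₂)
open import Data.Vec.Base as Vec using (Vec; []; _∷_; _∷ʳ_; tabulate)
open import Data.Vec.Properties using (tabulate-cong; tabulate-∘; ∷ʳ-injective; ++-injective)
open import Function.Base using (id; _∘_)
open import Function.Bundles using (_⇔_; mk⇔)
open import Function.Construct.Composition using (_⇔-∘_)
open import Function.Construct.Identity using (⇔-id; ↠-id)
open import Function.Construct.Symmetry using (⇔-sym)
open import Function.Properties.Equivalence using (⇔-setoid)
open import Function.Related.TypeIsomorphisms using (¬-cong-⇔)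
open import Level using (Level)
open import Relation.Binary.PropositionalEquality hiding (J)
open import Relation.Nullary using (¬_; yes; no; contradiction)
open import Relation.Nullary.Decidable using (¬?)
open import Relation.Unary using (_⊆_)
open import Defs

private
  variable
    a ℓ   : Level
    A B   : Set a
    k m n : ℕ
    σ τ   : ℕ → A

-- Updates of assignments, and tuples as prefixes of assignments.

subst-⇔ : ∀ (P : A → Set ℓ) {x y} → x ≡ y → P x ⇔ P y
subst-⇔ P refl = ⇔-id _

<∧≢pred⇒<pred : ∀ {i} → i < n → i ≢ pred n → i < pred n
<∧≢pred⇒<pred i<n = ≤∧≢⇒< (<⇒≤pred i<n)

-- The motive ranges over values, so this one case split serves both for bounds on indices and for
-- equations between values.
update-elim : ∀ {b} (P : A → Set b) {x : ℕ} {v : A} (i : ℕ) →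
              (i ≡ x → P v) → (i ≢ x → P (σ i)) → P ((σ [ x ↦ v ]) i)
update-elim P {x} i same other with i ≟ x
... | yes i≡x = same i≡x
... | no  i≢x = other i≢x

update-same : ∀ (σ : ℕ → A) x {v} → (σ [ x ↦ v ]) x ≡ v
update-same σ x = update-elim {σ = σ} (_≡ _) x (λ _ → refl) (contradiction refl)

update-other : ∀ (σ : ℕ → A) {x v i} → i ≢ x → (σ [ x ↦ v ]) i ≡ σ i
update-other σ {i = i} i≢x =
  update-elim {σ = σ} (_≡ _) i (λ i≡x → contradiction i≡x i≢x) (λ _ → refl)

update-cong : ∀ x {v : A} i → (i ≢ x → σ i ≡ τ i) → (σ [ x ↦ v ]) i ≡ (τ [ x ↦ v ]) i
update-cong x i eq with i ≟ x
... | yes _   = refl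
... | no  i≢x = eq i≢x

∘-update : ∀ (σ : A → B) (f : ℕ → A) x {v} i →
           σ ((f [ x ↦ v ]) i) ≡ ((σ ∘ f) [ x ↦ σ v ]) i
∘-update σ f x i with i ≟ x
... | yes _ = refl
... | no  _ = refl

prefix : ∀ k → (ℕ → A) → Vec A k
prefix k σ = tabulate {n = k} (σ ∘ toℕ)

fill : A → Vec A k → (ℕ → A)
fill d []       _       = d
fill d (x ∷ xs) zero    = x
fill d (x ∷ xs) (suc i) = fill d xs i

prefix-fill : ∀ (d : A) (xs : Vec A k) → prefix k (fill d xs) ≡ xs
prefix-fill d []       = refl
prefix-fill d (x ∷ xs) = cong (x ∷_) (prefix-fill d xs)

fill-∈ : ∀ (d : A) (xs : Vec A k) {i} → i < k → fill d xs i ∈ Vec.toList xs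
fill-∈ d (x ∷ xs) {zero}  i<k = here refl
fill-∈ d (x ∷ xs) {suc i} i<k = there (fill-∈ d xs (s<s⁻¹ i<k))

prefix-cong : (∀ {i} → i < k → σ i ≡ τ i) → prefix k σ ≡ prefix k τ
prefix-cong eq = tabulate-cong (λ i → eq (toℕ<n i))

map-cong-∈ : ∀ {f g : A → B} (xs : Vec A k) →
             (∀ {x} → x ∈ Vec.toList xs → f x ≡ g x) → Vec.map f xs ≡ Vec.map g xs
map-cong-∈ []       eq = refl
map-cong-∈ (x ∷ xs) eq = cong₂ _∷_ (eq (here refl)) (map-cong-∈ xs (eq ∘ there))

prefix-∘ : ∀ k (f : A → B) (σ : ℕ → A) → prefix k (f ∘ σ) ≡ Vec.map f (prefix k σ)
prefix-∘ k f σ = tabulate-∘ f (σ ∘ toℕ)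

prefix-∷ʳ : ∀ k (σ : ℕ → A) → prefix (suc k) σ ≡ prefix k σ ∷ʳ σ k
prefix-∷ʳ zero    σ = refl
prefix-∷ʳ (suc k) σ = cong (σ 0 ∷_) (prefix-∷ʳ k (σ ∘ suc))

prefix-++ : ∀ k l (σ : ℕ → A) → prefix (k + l) σ ≡ prefix k σ Vec.++ prefix l (σ ∘ (k +_))
prefix-++ zero    l σ = refl
prefix-++ (suc k) l σ = cong (σ 0 ∷_) (prefix-++ k l (σ ∘ suc))

cast-prefix : ∀ (eq : k ≡ n) (σ : ℕ → A) → Vec.cast eq (prefix k σ) ≡ prefix n σ
cast-prefix {k = zero}  refl σ = refl
cast-prefix {k = suc k} refl σ = cong (σ 0 ∷_) (cast-prefix refl (σ ∘ suc))

-- With tuples read as the first k values of an assignment σ, the operators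
-- p, s and I replace σ by σ ∘ cyc k, σ ∘ swap k and σ ∘ dup k.  This needs no
-- exception for k ≤ 1: all three then fix 0.
cyc swap dup : ℕ → ℕ → ℕ
cyc  k = suc [ pred k ↦ 0 ]
swap k = id [ pred k ↦ pred (pred k) ] [ pred (pred k) ↦ pred k ]
dup  k = id [ pred k ↦ pred (pred k) ]

cyc-< : ∀ {i} → i < k → cyc k i < k
cyc-< {k} {i} i<k = update-elim {σ = suc} (_< k) i
  (λ _ → m<n⇒0<n i<k)
  (λ i≢ → ≤-<-trans (<∧≢pred⇒<pred i<k i≢) (pred-< i<k))
  where
  pred-< : ∀ {j k} → j < k → pred k < k
  pred-< {k = suc k} _ = ≤-refl

swap-< : ∀ {i} → i < k → swap k i < k
swap-< {suc k} {i} i<k = update-elim {σ = id [ k ↦ pred k ]} (_< suc k) i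
  (λ _ → ≤-refl)
  (λ _ → update-elim {σ = id} (_< suc k) i (λ _ → s≤s pred[n]≤n) (λ _ → i<k))

dup-< : ∀ {i} → i < k → dup k i < arᴵ k
dup-< {suc zero}    {zero}  _ = ≤-refl
dup-< {suc zero}    {suc i} (s≤s ())
dup-< {suc (suc k)} {i} i<k = update-elim {σ = id} (_< suc k) i
  (λ _ → ≤-refl) (<∧≢pred⇒<pred i<k)

-- Powers of the cycle, and its composite with the transposition.

cyc-+ : ∀ j i → j + i < k → fold i (cyc k) j ≡ j + i
cyc-+ zero    i _ = refl
cyc-+ {k} (suc j) i j+i<k = trans (cong (cyc k) (cyc-+ j i (<-trans ≤-refl j+i<k)))
  (update-other suc (<⇒≢ (<⇒≤pred {n = k} j+i<k)))

-- From `i`, climb to the last index, wrap to 0 in one step, then climb `i` more: `k` steps in all.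
cyc-k : ∀ {i} → i < k → fold i (cyc k) k ≡ i
cyc-k {suc k} {i} i<k = begin
  fold i c (suc k)                 ≡⟨ cong (fold i c) k≡ ⟨
  fold i c (i + suc (k ∸ i))       ≡⟨ fold-+ i c i ⟩
  fold (c (fold i c (k ∸ i))) c i  ≡⟨ cong (λ x → fold (c x) c i) (cyc-+ (k ∸ i) i k∸i+i<k) ⟩
  fold (c (k ∸ i + i)) c i         ≡⟨ cong (λ x → fold (c x) c i) k∸i+i ⟩
  fold (c k) c i                   ≡⟨ cong (λ x → fold x c i) (update-same suc k) ⟩
  fold 0 c i                       ≡⟨ cyc-+ i 0 (subst (_< suc k) (sym (+-identityʳ i)) i<k) ⟩
  i + 0                            ≡⟨ +-identityʳ i ⟩
  i                                ∎
  where
  open ≡-Reasoning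
  c = cyc (suc k)
  k∸i+i : k ∸ i + i ≡ k
  k∸i+i = m∸n+n≡m (<⇒≤pred i<k)
  k∸i+i<k : k ∸ i + i < suc k
  k∸i+i<k = s≤s (≤-reflexive k∸i+i)
  k≡ : i + suc (k ∸ i) ≡ suc k
  k≡ = trans (+-suc i (k ∸ i)) (cong suc (m+[n∸m]≡n (<⇒≤pred i<k)))

-- A cycle of order `n + 1` has its `n`th power as inverse; this is why applying `p` another `n`
-- times rotates back.
cyc-inverse : ∀ {i} → i < suc n → fold (cyc (suc n) i) (cyc (suc n)) n ≡ i
cyc-inverse {n} {i} i<n = begin
  fold (c i) c n    ≡⟨ fold-+ i c n {1} ⟨
  fold i c (n + 1)  ≡⟨ cong (fold i c) (+-comm n 1) ⟩
  fold i c (suc n)  ≡⟨ cyc-k i<n ⟩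
  i                 ∎
  where
  open ≡-Reasoning
  c = cyc (suc n)

swap-last : ∀ n → swap (2 + n) (suc n) ≡ n
swap-last n = trans (update-other (id [ suc n ↦ n ]) {n} 1+n≢n) (update-same id (suc n))

swap-penultimate : ∀ n → swap (2 + n) n ≡ suc n
swap-penultimate n = update-same (id [ suc n ↦ n ]) n

swap-fixed : ∀ {i} → i < n → swap (2 + n) i ≡ i
swap-fixed {n} i<n = trans (update-other (id [ suc n ↦ n ]) {n} (<⇒≢ i<n))
  (update-other id {suc n} (<⇒≢ (m<n⇒m<1+n i<n)))

-- The transposition sends the last index to `n`, from where the cycle brings it back. Together with
-- `cyc-swap-<`, the composite is the cycle of the first `n + 1` indices.
cyc-swap-last : ∀ n → cyc (2 + n) (swap (2 + n) (suc n)) ≡ suc n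
cyc-swap-last n = trans (cong (cyc (2 + n)) (swap-last n))
  (update-other suc {suc n} (<⇒≢ ≤-refl))

cyc-swap-< : ∀ {i} → i < suc n → cyc (2 + n) (swap (2 + n) i) ≡ cyc (suc n) i
cyc-swap-< {n} {i} i<1+n with m<1+n⇒m<n∨m≡n i<1+n
... | inj₁ i<n = trans (cong (cyc (2 + n)) (swap-fixed i<n))
  (trans (update-other suc {suc n} (<⇒≢ i<1+n)) (sym (update-other suc {n} (<⇒≢ i<n))))
... | inj₂ refl = trans (cong (cyc (2 + n)) (swap-penultimate n))
  (trans (update-same suc (suc n)) (sym (update-same suc n)))

-- The inductive step of `Holds-identify`: `υ` is `σ` rotated back, which moves the value of column
-- `c` to `c + 1`, and the rotation by the composite cancels against it.
rotate-update : ∀ (σ : ℕ → A) {c i} → c < n → i < 2 + n →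
                let υ j = σ (fold j (cyc (suc n)) n) in
                (υ [ suc n ↦ υ (suc c) ]) (cyc (2 + n) (swap (2 + n) i)) ≡
                (σ [ suc n ↦ σ c ]) i
rotate-update {n = n} σ {c} {i} c<n i<2+n = go (m<1+n⇒m<n∨m≡n i<2+n)
  where
  open ≡-Reasoning
  υ ρ : ℕ → _
  υ j = σ (fold j (cyc (suc n)) n)
  ρ = υ [ suc n ↦ υ (suc c) ]

  go : i < suc n ⊎ i ≡ suc n →
       ρ (cyc (2 + n) (swap (2 + n) i)) ≡ (σ [ suc n ↦ σ c ]) i
  go (inj₁ i<1+n) = begin
    ρ (cyc (2 + n) (swap (2 + n) i)) ≡⟨ cong ρ (cyc-swap-< i<1+n) ⟩
    ρ (cyc (suc n) i)                ≡⟨ update-other υ (<⇒≢ (cyc-< i<1+n)) ⟩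
    υ (cyc (suc n) i)                ≡⟨ cong σ (cyc-inverse i<1+n) ⟩
    σ i                              ≡⟨ update-other σ (<⇒≢ i<1+n) ⟨
    (σ [ suc n ↦ σ c ]) i            ∎
  go (inj₂ refl) = begin
    ρ (cyc (2 + n) (swap (2 + n) (suc n))) ≡⟨ cong ρ (cyc-swap-last n) ⟩
    ρ (suc n)                              ≡⟨ update-same υ (suc n) ⟩
    -- As `c < n`, the cycle takes `c` to `c + 1` without wrapping.
    υ (suc c)                              ≡⟨ cong υ (update-other suc (<⇒≢ c<n)) ⟨
    υ (cyc (suc n) c)                      ≡⟨ cong σ (cyc-inverse (m<n⇒m<1+n c<n)) ⟩
    σ c                                    ≡⟨ update-same σ (suc n) ⟨
    (σ [ suc n ↦ σ c ]) (suc n)            ∎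

splice : ℕ → (ℕ → A) → (ℕ → A) → (ℕ → A)
splice n σ τ i with i <? n
... | yes _ = σ i
... | no  _ = τ (i ∸ n)

splice-< : ∀ (σ τ : ℕ → A) {i} → i < n → splice n σ τ i ≡ σ i
splice-< {n = n} σ τ {i} i<n with i <? n
... | yes _   = refl
... | no  i≮n = contradiction i<n i≮n

splice-+ : ∀ (σ τ : ℕ → A) n i → splice n σ τ (n + i) ≡ τ i
splice-+ σ τ n i with n + i <? n
... | yes n+i<n = contradiction n+i<n (m+n≮m n i)
... | no  _     = cong τ (m+n∸m≡n n i)

-- Substitution in terms

-- The relation Aⁿ: `I e` holds of every element, and its projection is the 0-ary truth because
-- domains are nonempty.
full : ℕ → Term
full zero    = ∃ᵗ (I e)
full (suc n) = J (I e) (full n)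

ar-full : ∀ n → ar (full n) ≡ n
ar-full zero    = refl
ar-full (suc n) = cong suc (ar-full n)

ar-rotate : ∀ T n → ar (fold T p n) ≡ ar T
ar-rotate T zero    = refl
ar-rotate T (suc n) = ar-rotate T n

-- In a relation of arity 2 + n, equates the last column with the column c
-- such that c + d ≡ n, and drops the former.  The composite p ∘ s rotates all
-- columns but the last, so it reduces d by one; p^n rotates back.
identify : (d n : ℕ) → Term → Term
identify zero    n T = I T
identify (suc d) n T = fold (identify d n (p (s T))) p n

ar-identify : ∀ d T → ar T ≡ 2 + n → ar (identify d n T) ≡ suc n
ar-identify zero    T eq = cong arᴵ eq
ar-identify {n} (suc d) T eq =
  trans (ar-rotate (identify d n (p (s T))) n) (ar-identify d (p (s T)) eq)

-- The last column is `m`; the index `c` is converted to its distance from the penultimate column,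
-- on which `identify` recurs.
contract : (m c : ℕ) → Term → Term
contract m c T = identify (pred m ∸ c) (pred m) T

ar-contract : ∀ {c} T → ar T ≡ suc m → c < m → ar (contract m c T) ≡ m
ar-contract {suc m} {c} T eq _ = ar-identify (m ∸ c) T eq

-- Equates column n + i with column g i and drops it, for all i < j.
collapse : (n : ℕ) → (ℕ → ℕ) → ℕ → Term → Term
collapse n g zero    T = T
collapse n g (suc j) T = collapse n g j (contract (n + j) (g j) T)

ar-collapse : ∀ g j T → ar T ≡ n + j → (∀ {i} → i < j → g i < n) →
              ar (collapse n g j T) ≡ n
ar-collapse {n} g zero    T eq g< = trans eq (+-identityʳ n)
ar-collapse {n} g (suc j) T eq g< = ar-collapse g j _
  (ar-contract T (trans eq (+-suc n j)) (<-≤-trans (g< ≤-refl) (m≤m+n n j)))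
  (λ i<j → g< (m<n⇒m<1+n i<j))

-- Columns outside the image of `g` stay unrestricted, as they come from `full n`; hence `g` may
-- repeat columns and omit others.
substitute : ℕ → (ℕ → ℕ) → Term → Term
substitute n g T = collapse n g (ar T) (J (full n) T)

ar-substitute : ∀ g T → (∀ {i} → i < ar T → g i < n) → ar (substitute n g T) ≡ n
ar-substitute {n} g T = ar-collapse g (ar T) (J (full n) T) (cong (_+ ar T) (ar-full n))

-- The operators on AD-relations as renamings of assignments

prefix-∷ʳ-∷ʳ : ∀ n (σ : ℕ → A) → prefix (2 + n) σ ≡ prefix n σ ∷ʳ σ n ∷ʳ σ (suc n)
prefix-∷ʳ-∷ʳ n σ = trans (prefix-∷ʳ (suc n) σ) (cong (_∷ʳ σ (suc n)) (prefix-∷ʳ n σ))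

prefix-cyc : ∀ n (σ : ℕ → A) → prefix n (σ ∘ suc) ∷ʳ σ 0 ≡ prefix (suc n) (σ ∘ cyc (suc n))
prefix-cyc n σ = sym (trans (prefix-∷ʳ n (σ ∘ cyc (suc n))) (cong₂ _∷ʳ_
  (prefix-cong (λ i<n → cong σ (update-other suc {n} (<⇒≢ i<n))))
  (cong σ (update-same suc n))))

prefix-swap : ∀ n (σ : ℕ → A) →
              prefix n σ ∷ʳ σ (suc n) ∷ʳ σ n ≡ prefix (2 + n) (σ ∘ swap (2 + n))
prefix-swap n σ = sym (trans (prefix-∷ʳ-∷ʳ n (σ ∘ swap (2 + n))) (cong₂ _∷ʳ_ (cong₂ _∷ʳ_
  (prefix-cong (λ i<n → cong σ (swap-fixed i<n)))
  (cong σ (swap-penultimate n)))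
  (cong σ (swap-last n))))

prefix-dup : ∀ n (σ : ℕ → A) →
             prefix n σ ∷ʳ σ n ∷ʳ σ n ≡ prefix (2 + n) (σ ∘ dup (2 + n))
prefix-dup n σ = sym (trans (prefix-∷ʳ-∷ʳ n (σ ∘ dup (2 + n))) (cong₂ _∷ʳ_ (cong₂ _∷ʳ_
  (prefix-cong (λ i<n → cong σ (update-other id {suc n} (<⇒≢ (m<n⇒m<1+n i<n)))))
  (cong σ (update-other id {suc n} (<⇒≢ ≤-refl))))
  (cong σ (update-same id (suc n)))))

pᴿ-prefix : ∀ k (R : Rel A k) σ → pᴿ R (prefix k σ) ⇔ R (prefix k (σ ∘ cyc k))
pᴿ-prefix zero          R σ = ⇔-id _
pᴿ-prefix (suc zero)    R σ = ⇔-id _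
pᴿ-prefix (suc (suc n)) R σ = mk⇔
  (λ { (as , a , r , refl) → subst R (prefix-cyc (suc n) σ) r })
  (λ r → _ , _ , subst R (sym (prefix-cyc (suc n) σ)) r , refl)

sᴿ-prefix : ∀ k (R : Rel A k) σ → sᴿ R (prefix k σ) ⇔ R (prefix k (σ ∘ swap k))
sᴿ-prefix zero          R σ = ⇔-id _
sᴿ-prefix (suc zero)    R σ = ⇔-id _
sᴿ-prefix (suc (suc n)) R σ = mk⇔
  to
  (λ r → _ , _ , _ , subst R (sym (prefix-swap n σ)) r , prefix-∷ʳ-∷ʳ n σ)
  where
  to : sᴿ R (prefix (2 + n) σ) → R (prefix (2 + n) (σ ∘ swap (2 + n)))
  to (as , a , b , r , eq)
    with eq₁ , refl ← ∷ʳ-injective (prefix n σ ∷ʳ σ n) (as ∷ʳ b)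
                        (trans (sym (prefix-∷ʳ-∷ʳ n σ)) eq)
    with refl , refl ← ∷ʳ-injective (prefix n σ) as eq₁ = subst R (prefix-swap n σ) r

Iᴿ-prefix : ∀ k (R : Rel A k) σ → Iᴿ R (prefix (arᴵ k) σ) ⇔ R (prefix k (σ ∘ dup k))
Iᴿ-prefix zero          R σ = ⇔-id _
Iᴿ-prefix (suc zero)    R σ = ⇔-id _
Iᴿ-prefix (suc (suc n)) R σ = mk⇔
  to
  (λ r → _ , _ , _ , subst R (sym (prefix-dup n σ)) r , refl , prefix-∷ʳ n σ)
  where
  to : Iᴿ R (prefix (suc n) σ) → R (prefix (2 + n) (σ ∘ dup (2 + n)))
  to (as , a , .a , r , refl , eq)
    with refl , refl ← ∷ʳ-injective (prefix n σ) as (trans (sym (prefix-∷ʳ n σ)) eq) =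
    subst R (prefix-dup n σ) r

Jᴿ-prefix : ∀ k l (R : Rel A k) (S : Rel A l) σ →
            Jᴿ R S (prefix (k + l) σ) ⇔ (R (prefix k σ) × S (prefix l (σ ∘ (k +_))))
Jᴿ-prefix k l R S σ = mk⇔
  to
  (λ (r , q) → _ , _ , r , q , prefix-++ k l σ)
  where
  to : Jᴿ R S (prefix (k + l) σ) → R (prefix k σ) × S (prefix l (σ ∘ (k +_)))
  to (as , bs , r , q , eq)
    with refl , refl ← ++-injective (prefix k σ) as (trans (sym (prefix-++ k l σ)) eq) = r , q

∃ᴿ-prefix : ∀ (d : A) k (R : Rel A k) σ →
            ∃ᴿ R (prefix (pred k) σ) ⇔ (∃[ a ] R (prefix k (σ [ pred k ↦ a ])))
-- Projection leaves a 0-ary relation alone, while the right-hand side quantifies over the domain;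
-- `d` is its witness.
∃ᴿ-prefix d zero    R σ = mk⇔ (d ,_) proj₂
∃ᴿ-prefix d (suc n) R σ = Σ-⇔ (↠-id _) (λ {a} → subst-⇔ R (eq a))
  where
  eq : ∀ a → prefix n σ ∷ʳ a ≡ prefix (suc n) (σ [ n ↦ a ])
  eq a = sym (trans (prefix-∷ʳ n (σ [ n ↦ a ])) (cong₂ _∷ʳ_
    (prefix-cong (λ i<n → update-other σ (<⇒≢ i<n))) (update-same σ n)))

-- Translations

fresh : (ℕ → Var) → ℕ → Var
fresh f zero    = 0
fresh f (suc k) = suc (f k) ⊔ fresh f k

<-fresh : ∀ f {i} → i < k → f i < fresh f k
<-fresh {suc k} f i<1+k with m<1+n⇒m<n∨m≡n i<1+k
... | inj₁ i<k  = <-≤-trans (<-fresh f i<k) (m≤n⊔m (suc (f k)) (fresh f k))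
... | inj₂ refl = m≤m⊔n (suc (f k)) (fresh f k)

-- Column `i` is named by the variable `f i`. The quantified column gets a variable above those of
-- all remaining columns, so nothing is captured.
toFormula : Term → (ℕ → Var) → Formula
toFormula (rel R) f = rel R (prefix (Symbol.arity R) f)
toFormula e       f = f 0 ≐ f 1
toFormula (p T)   f = toFormula T (f ∘ cyc (ar T))
toFormula (s T)   f = toFormula T (f ∘ swap (ar T))
toFormula (I T)   f = toFormula T (f ∘ dup (ar T))
toFormula (¬ᵗ T)  f = ¬ᶠ (toFormula T f)
toFormula (J T S) f = toFormula T f ∧ᶠ toFormula S (f ∘ (ar T +_))
toFormula (∃ᵗ T)  f = ∃ᶠ x (toFormula T (f [ pred (ar T) ↦ x ]))
  where x = fresh f (pred (ar T))

∈-prefix : ∀ k (f : ℕ → A) {x} → x ∈ Vec.toList (prefix k f) → ∃[ i ] i < k × x ≡ f i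
∈-prefix (suc k) f (here x≡)  = 0 , z<s , x≡
∈-prefix (suc k) f (there x∈) =
  let i , i<k , x≡ = ∈-prefix k (f ∘ suc) x∈ in suc i , s<s i<k , x≡

-- This bounds the free variables from above; `trivial` supplies the bound from below.
fv-toFormula : ∀ T f {x} → x ∈ fv (toFormula T f) → ∃[ i ] i < ar T × x ≡ f i
fv-toFormula (rel R) f x∈ = ∈-prefix _ f x∈
fv-toFormula e       f (here x≡)         = 0 , z<s , x≡
fv-toFormula e       f (there (here x≡)) = 1 , s<s z<s , x≡
fv-toFormula (p T)   f x∈ =
  let i , i< , x≡ = fv-toFormula T _ x∈ in _ , cyc-< i< , x≡
fv-toFormula (s T)   f x∈ =
  let i , i< , x≡ = fv-toFormula T _ x∈ in _ , swap-< i< , x≡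
fv-toFormula (I T)   f x∈ =
  let i , i< , x≡ = fv-toFormula T _ x∈ in _ , dup-< i< , x≡
fv-toFormula (¬ᵗ T)  f x∈ = fv-toFormula T f x∈
fv-toFormula (J T S) f x∈ with ∈-++⁻ (fv (toFormula T f)) x∈
... | inj₁ x∈T = let i , i< , x≡ = fv-toFormula T f x∈T in i , <-≤-trans i< (m≤m+n _ _) , x≡
... | inj₂ x∈S = let i , i< , x≡ = fv-toFormula S _ x∈S in _ , +-monoʳ-< (ar T) i< , x≡
fv-toFormula (∃ᵗ T)  f {x} x∈
  with x∈T , x≢y ← ∈-filter⁻ (λ z → ¬? (z ≟ fresh f (pred (ar T))))
                      {xs = fv (toFormula T (f [ pred (ar T) ↦ _ ]))} x∈
  with i , i< , x≡ ← fv-toFormula T _ x∈T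
  with i ≟ pred (ar T)
-- The last column carries the bound variable, which `filter` has removed.
... | yes _  = contradiction x≡ x≢y
... | no i≢  = i , <∧≢pred⇒<pred i< i≢ , x≡

-- Conjoined to a formula, it makes 0, …, k - 1 free without changing the truth value.
trivial : ℕ → Formula
trivial zero    = ∃ᶠ 0 (0 ≐ 0)
trivial (suc k) = trivial k ∧ᶠ (k ≐ k)

fv-trivial⁺ : ∀ {i} → i < k → i ∈ fv (trivial k)
fv-trivial⁺ {suc k} i<1+k with m<1+n⇒m<n∨m≡n i<1+k
... | inj₁ i<k  = ∈-++⁺ˡ (fv-trivial⁺ i<k)
... | inj₂ refl = ∈-++⁺ʳ (fv (trivial k)) (here refl)

fv-trivial⁻ : ∀ k {i} → i ∈ fv (trivial k) → i < k
fv-trivial⁻ zero    ()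
fv-trivial⁻ (suc k) i∈ with ∈-++⁻ (fv (trivial k)) i∈
... | inj₁ i∈k                 = m<n⇒m<1+n (fv-trivial⁻ k i∈k)
... | inj₂ (here refl)         = ≤-refl
... | inj₂ (there (here refl)) = ≤-refl

-- Free variables in increasing order.

-- A copy of the bound local to `freeVars`; the two agree definitionally at `fv φ`.
bound : List Var → ℕ
bound = foldr (λ x n → suc x ⊔ n) 0

<-bound : ∀ {xs x} → x ∈ xs → x < bound xs
<-bound {y ∷ ys} (here refl) = m≤m⊔n (suc y) (bound ys)
<-bound {y ∷ ys} (there x∈)  = <-≤-trans (<-bound x∈) (m≤n⊔m (suc y) (bound ys))

bound-≤ : ∀ xs → (∀ {x} → x ∈ xs → x < k) → bound xs ≤ k
bound-≤ []       xs<k = z≤n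
bound-≤ (x ∷ xs) xs<k = ⊔-lub (xs<k (here refl)) (bound-≤ xs (xs<k ∘ there))

bound-≥ : ∀ k {xs} → (∀ {i} → i < k → i ∈ xs) → k ≤ bound xs
bound-≥ zero    <k∈ = z≤n
bound-≥ (suc k) <k∈ = <-bound (<k∈ ≤-refl)

∈-freeVars : ∀ φ {x} → x ∈ fv φ → x ∈ freeVars φ
∈-freeVars φ x∈ = ∈-filter⁺ (λ x → _∈?_ _≟_ x (fv φ)) (∈-upTo⁺ (<-bound x∈)) x∈

-- The two inclusions force the bound to be `k`, and then the filter discards nothing.
freeVars-upTo : ∀ φ → (∀ {i} → i ∈ fv φ → i < k) → (∀ {i} → i < k → i ∈ fv φ) →
                freeVars φ ≡ upTo k
freeVars-upTo {k} φ fv⊆ fv⊇ = trans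
  (cong (λ n → filter (λ x → _∈?_ _≟_ x (fv φ)) (upTo n))
        (≤-antisym (bound-≤ (fv φ) fv⊆) (bound-≥ k fv⊇)))
  (filter-all _ (All.tabulate (fv⊇ ∘ ∈-upTo⁻)))

position : List Var → Var → ℕ
position []       x = 0
position (y ∷ ys) x with x ≟ y
... | yes _ = 0
... | no  _ = suc (position ys x)

position-< : ∀ {xs x} → x ∈ xs → position xs x < length xs
position-< {y ∷ ys} {x} x∈ with x ≟ y | x∈
... | yes _   | _          = z<s
... | no  x≢y | here x≡y   = contradiction x≡y x≢y
... | no  _   | there x∈ys = s<s (position-< x∈ys)

-- Generalised from `upTo k`, which is `applyUpTo id k`, because the tail of the list is built from
-- `f ∘ suc`.
position-applyUpTo : ∀ (f : ℕ → Var) → (∀ {i j} → f i ≡ f j → i ≡ j) →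
                     ∀ {i} → i < k → position (applyUpTo f k) (f i) ≡ i
position-applyUpTo {suc k} f inj {zero} i<k with f 0 ≟ f 0
... | yes _   = refl
... | no  f≢f = contradiction refl f≢f
position-applyUpTo {suc k} f inj {suc i} i<k with f (suc i) ≟ f 0
... | yes eq = contradiction (inj eq) 1+n≢0
... | no  _  = cong suc (position-applyUpTo (f ∘ suc) (suc-injective ∘ inj) (s<s⁻¹ i<k))

-- f assigns to each free variable its column among the n columns.
toTerm : (n : ℕ) → (Var → ℕ) → Formula → Term
toTerm n f (rel R xs) = substitute n (f ∘ fill 0 xs) (rel R)
toTerm n f (x ≐ y)    = substitute n (f ∘ fill 0 (x ∷ y ∷ [])) e
toTerm n f (¬ᶠ φ)     = ¬ᵗ (toTerm n f φ)
toTerm n f (φ ∧ᶠ ψ)   = substitute n (splice n id id) (J (toTerm n f φ) (toTerm n f ψ))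
toTerm n f (∃ᶠ x φ)   = ∃ᵗ (toTerm (suc n) (f [ x ↦ n ]) φ)

Bounded : ℕ → (Var → ℕ) → Formula → Set
Bounded n f φ = ∀ {x} → x ∈ fv φ → f x < n

bounded-∃ : ∀ {f x} φ → Bounded n f (∃ᶠ x φ) → Bounded (suc n) (f [ x ↦ n ]) φ
bounded-∃ {n} {f} {x} φ f< {y} y∈ = update-elim {σ = f} (_< suc n) y
  (λ _ → ≤-refl)
  (λ y≢x → m<n⇒m<1+n (f< (∈-filter⁺ (λ z → ¬? (z ≟ x)) y∈ y≢x)))

-- `splice n id id` sends both `i < n` and `n + i` to `i`: it lays the two blocks of a join over
-- each other, as conjunction requires.
splice-id-< : ∀ {l i} → k ≡ n → l ≡ n → i < k + l → splice n id id i < n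
splice-id-< {n = n} {i = i} refl refl i<n+n with i <? n
... | yes i<n = i<n
... | no  i≮n = +-cancelˡ-< n (i ∸ n) n (subst (_< n + n) (sym (m+[n∸m]≡n (≮⇒≥ i≮n))) i<n+n)

ar-toTerm : ∀ f φ → Bounded n f φ → ar (toTerm n f φ) ≡ n
ar-toTerm f (rel R xs) f< = ar-substitute _ (rel R) (f< ∘ fill-∈ 0 xs)
ar-toTerm f (x ≐ y)    f< = ar-substitute _ e (f< ∘ fill-∈ 0 (x ∷ y ∷ []))
ar-toTerm f (¬ᶠ φ)     f< = ar-toTerm f φ f<
ar-toTerm {n} f (φ ∧ᶠ ψ)   f< = ar-substitute _ (J (toTerm n f φ) (toTerm n f ψ))
  (splice-id-< (ar-toTerm f φ (f< ∘ ∈-++⁺ˡ)) (ar-toTerm f ψ (f< ∘ ∈-++⁺ʳ (fv φ))))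
ar-toTerm f (∃ᶠ x φ)   f< = cong pred (ar-toTerm _ φ (bounded-∃ φ f<))

-- Evaluation of terms and formulas

module _ (𝔄 : Model ℓ) where
  open Model 𝔄
  open import Relation.Binary.Reasoning.Setoid (⇔-setoid ℓ)

  -- Membership in the vocabulary is made part of the truth of an atom, so that
  -- terms and formulas can be evaluated without assumptions on their symbols.
  Holds : Term → (ℕ → Domain) → Set ℓ
  Holds (rel R) σ = Σ[ v ∈ vocabulary R ] interp R v (prefix (Symbol.arity R) σ)
  Holds e       σ = σ 0 ≡ σ 1
  Holds (p T)   σ = Holds T (σ ∘ cyc (ar T))
  Holds (s T)   σ = Holds T (σ ∘ swap (ar T))
  Holds (I T)   σ = Holds T (σ ∘ dup (ar T))
  Holds (¬ᵗ T)  σ = ¬ Holds T σ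
  Holds (J T S) σ = Holds T σ × Holds S (σ ∘ (ar T +_))
  Holds (∃ᵗ T)  σ = ∃[ a ] Holds T (σ [ pred (ar T) ↦ a ])

  ⟦⟧ᵗ⇔Holds : ∀ T (h : symbolsᵗ T ⊆ vocabulary) σ →
              ⟦_⟧ᵗ 𝔄 T h (prefix (ar T) σ) ⇔ Holds T σ
  ⟦⟧ᵗ⇔Holds (rel R) h σ = mk⇔ (h refl ,_) proj₂
  ⟦⟧ᵗ⇔Holds e       h σ = mk⇔
    (λ (a , eq) → trans (cong Vec.head eq) (sym (cong (Vec.head ∘ Vec.tail) eq)))
    (λ eq → σ 0 , cong (λ a → σ 0 ∷ a ∷ []) (sym eq))
  ⟦⟧ᵗ⇔Holds (p T)   h σ = ⟦⟧ᵗ⇔Holds T h _ ⇔-∘ pᴿ-prefix (ar T) _ σ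
  ⟦⟧ᵗ⇔Holds (s T)   h σ = ⟦⟧ᵗ⇔Holds T h _ ⇔-∘ sᴿ-prefix (ar T) _ σ
  ⟦⟧ᵗ⇔Holds (I T)   h σ = ⟦⟧ᵗ⇔Holds T h _ ⇔-∘ Iᴿ-prefix (ar T) _ σ
  ⟦⟧ᵗ⇔Holds (¬ᵗ T)  h σ = ¬-cong-⇔ (⟦⟧ᵗ⇔Holds T h σ)
  ⟦⟧ᵗ⇔Holds (J T S) h σ =
    (⟦⟧ᵗ⇔Holds T (h ∘ inj₁) σ ×-⇔ ⟦⟧ᵗ⇔Holds S (h ∘ inj₂) _)
      ⇔-∘ Jᴿ-prefix (ar T) (ar S) _ _ σ
  ⟦⟧ᵗ⇔Holds (∃ᵗ T)  h σ =
    Σ-⇔ (↠-id _) (⟦⟧ᵗ⇔Holds T h _) ⇔-∘ ∃ᴿ-prefix element (ar T) _ σ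

  -- The renamings stay below the arity, so a term never reads past its first `ar T` values.
  Holds-cong : ∀ T {σ τ} → (∀ {i} → i < ar T → σ i ≡ τ i) → Holds T σ ⇔ Holds T τ
  Holds-cong (rel R) eq =
    Σ-⇔ (↠-id _) (λ {v} → subst-⇔ (interp R v) (prefix-cong eq))
  Holds-cong e       eq = mk⇔
    (λ x → trans (sym (eq z<s)) (trans x (eq (s<s z<s))))
    (λ x → trans (eq z<s) (trans x (sym (eq (s<s z<s)))))
  Holds-cong (p T)   eq = Holds-cong T (eq ∘ cyc-<)
  Holds-cong (s T)   eq = Holds-cong T (eq ∘ swap-<)
  Holds-cong (I T)   eq = Holds-cong T (eq ∘ dup-<)
  Holds-cong (¬ᵗ T)  eq = ¬-cong-⇔ (Holds-cong T eq)
  Holds-cong (J T S) eq =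
    Holds-cong T (λ i< → eq (<-≤-trans i< (m≤m+n _ _))) ×-⇔
    Holds-cong S (λ i< → eq (+-monoʳ-< (ar T) i<))
  Holds-cong (∃ᵗ T)  eq = Σ-⇔ (↠-id _) (Holds-cong T (λ {i} i< →
    update-cong (pred (ar T)) i (eq ∘ <∧≢pred⇒<pred i<)))

  Holds-full : ∀ n σ → Holds (full n) σ
  Holds-full zero    σ = element , refl
  Holds-full (suc n) σ = refl , Holds-full n _

  Holds-rotate : ∀ T n {σ} → Holds (fold T p n) σ ⇔
                 Holds T (λ i → σ (fold i (cyc (ar T)) n))
  Holds-rotate T zero    = ⇔-id _
  Holds-rotate T (suc n) {σ} = Holds-cong T
    (λ {i} _ → cong (λ k → σ (cyc k (fold i (cyc (ar T)) n))) (ar-rotate T n))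
    ⇔-∘ Holds-rotate T n

  -- Induction on the distance `d` from column `c` to the penultimate column `n`: at distance 0 the
  -- operator `I` applies, otherwise `rotate-update` passes to `c + 1`.
  Holds-identify : ∀ d {n c} T {σ} → ar T ≡ 2 + n → c + d ≡ n →
                   Holds (identify d n T) σ ⇔ Holds T (σ [ suc n ↦ σ c ])
  Holds-identify zero {n} {c} T {σ} eq c+d≡n = Holds-cong T λ {i} _ →
    trans (cong (λ k → σ (dup k i)) eq) (trans (∘-update σ id (suc n) i)
      (cong (λ j → (σ [ suc n ↦ σ j ]) i) (trans (sym c+d≡n) (+-identityʳ c))))
  Holds-identify (suc d) {n} {c} T {σ} eq c+d≡n = begin
    Holds (fold U p n) σ
      ≈⟨ Holds-rotate U n ⟩
    Holds U (λ i → σ (fold i (cyc (ar U)) n))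
      ≡⟨ cong (λ k → Holds U (λ i → σ (fold i (cyc k) n))) (ar-identify d (p (s T)) eq) ⟩
    Holds U υ
      ≈⟨ Holds-identify d (p (s T)) eq (trans (sym (+-suc c d)) c+d≡n) ⟩
    Holds T (ρ ∘ cyc (ar T) ∘ swap (ar T))
      ≈⟨ Holds-cong T (λ {i} i< → trans (cong (λ k → ρ (cyc k (swap k i))) eq)
                                        (rotate-update σ c<n (subst (i <_) eq i<))) ⟩
    Holds T (σ [ suc n ↦ σ c ])
      ∎
    where
    U = identify d n (p (s T))
    υ : ℕ → Domain
    υ i = σ (fold i (cyc (suc n)) n)
    ρ = υ [ suc n ↦ υ (suc c) ]
    c<n : c < n
    c<n = subst (c <_) c+d≡n (m<m+n c z<s)

  Holds-contract : ∀ {m c} T {σ} → ar T ≡ suc m → c < m →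
                   Holds (contract m c T) σ ⇔ Holds T (σ [ m ↦ σ c ])
  Holds-contract {suc m} {c} T eq c<m =
    Holds-identify (m ∸ c) T eq (m+[n∸m]≡n (<⇒≤pred c<m))

  -- Since `τ` already satisfies all the equations between columns, the update made by each
  -- contraction leaves it unchanged, and one `τ` serves the whole induction.
  Holds-collapse : ∀ {n} g j T {σ τ} → ar T ≡ n + j → (∀ {i} → i < j → g i < n) →
                   (∀ {i} → i < n → τ i ≡ σ i) → (∀ {i} → i < j → τ (n + i) ≡ σ (g i)) →
                   Holds (collapse n g j T) σ ⇔ Holds T τ
  Holds-collapse {n} g zero    T eq g< eq₁ eq₂ =
    Holds-cong T (λ i< → sym (eq₁ (subst (_ <_) (trans eq (+-identityʳ n)) i<)))
  Holds-collapse {n} g (suc j) T {σ} {τ} eq g< eq₁ eq₂ = begin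
    Holds (collapse n g j U) σ
      ≈⟨ Holds-collapse g j U (ar-contract T eq′ c<) (g< ∘ m<n⇒m<1+n) eq₁ (eq₂ ∘ m<n⇒m<1+n) ⟩
    Holds U τ
      ≈⟨ Holds-contract T eq′ c< ⟩
    Holds T (τ [ n + j ↦ τ (g j) ])
      ≈⟨ Holds-cong T (λ {i} _ → update-elim {σ = τ} (_≡ τ i) i
           (λ i≡ → trans (eq₁ (g< ≤-refl)) (trans (sym (eq₂ ≤-refl)) (cong τ (sym i≡))))
           (λ _ → refl)) ⟩
    Holds T τ
      ∎
    where
    U = contract (n + j) (g j) T
    eq′ : ar T ≡ suc (n + j)
    eq′ = trans eq (+-suc n j)
    c< : g j < n + j
    c< = <-≤-trans (g< ≤-refl) (m≤m+n n j)

  Holds-substitute : ∀ {n} g T {σ} → (∀ {i} → i < ar T → g i < n) →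
                     Holds (substitute n g T) σ ⇔ Holds T (σ ∘ g)
  Holds-substitute {n} g T {σ} g< = begin
    Holds (substitute n g T) σ
      ≈⟨ Holds-collapse g (ar T) (J (full n) T) (cong (_+ ar T) (ar-full n)) g<
           (splice-< σ (σ ∘ g)) (λ {i} _ → splice-+ σ (σ ∘ g) n i) ⟩
    (Holds (full n) υ × Holds T (υ ∘ (ar (full n) +_)))
      ≈⟨ mk⇔ proj₂ (Holds-full n υ ,_) ⟩
    Holds T (υ ∘ (ar (full n) +_))
      ≈⟨ Holds-cong T (λ {i} _ → trans (cong (λ k → υ (k + i)) (ar-full n))
                                       (splice-+ σ (σ ∘ g) n i)) ⟩
    Holds T (σ ∘ g)
      ∎
    -- The values of `σ` on the columns of `full n`, followed by those of `σ ∘ g` on the columns of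
    -- `T`.
    where υ = splice n σ (σ ∘ g)

  -- Atoms include membership in the vocabulary, as in `Holds`, so the translations can be verified
  -- without comparing symbol sets.
  TrueAt : Formula → (Var → Domain) → Set ℓ
  TrueAt (rel R xs) σ = Σ[ v ∈ vocabulary R ] interp R v (Vec.map σ xs)
  TrueAt (x ≐ y)    σ = σ x ≡ σ y
  TrueAt (¬ᶠ φ)     σ = ¬ TrueAt φ σ
  TrueAt (φ ∧ᶠ ψ)   σ = TrueAt φ σ × TrueAt ψ σ
  TrueAt (∃ᶠ x φ)   σ = ∃[ a ] TrueAt φ (σ [ x ↦ a ])

  Sat⇔TrueAt : ∀ φ (h : symbolsᶠ φ ⊆ vocabulary) σ → Sat 𝔄 φ h σ ⇔ TrueAt φ σ
  Sat⇔TrueAt (rel R xs) h σ = mk⇔ (h refl ,_) proj₂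
  Sat⇔TrueAt (x ≐ y)    h σ = ⇔-id _
  Sat⇔TrueAt (¬ᶠ φ)     h σ = ¬-cong-⇔ (Sat⇔TrueAt φ h σ)
  Sat⇔TrueAt (φ ∧ᶠ ψ)   h σ = Sat⇔TrueAt φ (h ∘ inj₁) σ ×-⇔ Sat⇔TrueAt ψ (h ∘ inj₂) σ
  Sat⇔TrueAt (∃ᶠ x φ)   h σ = Σ-⇔ (↠-id _) (Sat⇔TrueAt φ h _)

  TrueAt-cong : ∀ φ {σ τ} → (∀ {x} → x ∈ fv φ → σ x ≡ τ x) → TrueAt φ σ ⇔ TrueAt φ τ
  TrueAt-cong (rel R xs) eq = Σ-⇔ (↠-id _) (λ {v} → subst-⇔ (interp R v) (map-cong-∈ xs eq))
  TrueAt-cong (x ≐ y)    eq = mk⇔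
    (λ x≡y → trans (sym (eq (here refl))) (trans x≡y (eq (there (here refl)))))
    (λ x≡y → trans (eq (here refl)) (trans x≡y (sym (eq (there (here refl))))))
  TrueAt-cong (¬ᶠ φ)     eq = ¬-cong-⇔ (TrueAt-cong φ eq)
  TrueAt-cong (φ ∧ᶠ ψ)   eq =
    TrueAt-cong φ (eq ∘ ∈-++⁺ˡ) ×-⇔ TrueAt-cong ψ (eq ∘ ∈-++⁺ʳ (fv φ))
  TrueAt-cong (∃ᶠ x φ)   eq = Σ-⇔ (↠-id _) (TrueAt-cong φ (λ {y} y∈ →
    update-cong x y (eq ∘ ∈-filter⁺ (λ z → ¬? (z ≟ x)) y∈)))

  -- Both sides carry the same renamings, so only relation atoms and the choice of the bound
  -- variable need an argument.
  TrueAt-toFormula : ∀ T f {σ} → TrueAt (toFormula T f) σ ⇔ Holds T (σ ∘ f)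
  TrueAt-toFormula (rel R) f {σ} =
    Σ-⇔ (↠-id _) (λ {v} → subst-⇔ (interp R v) (sym (prefix-∘ _ σ f)))
  TrueAt-toFormula e       f = ⇔-id _
  TrueAt-toFormula (p T)   f = TrueAt-toFormula T _
  TrueAt-toFormula (s T)   f = TrueAt-toFormula T _
  TrueAt-toFormula (I T)   f = TrueAt-toFormula T _
  TrueAt-toFormula (¬ᵗ T)  f = ¬-cong-⇔ (TrueAt-toFormula T f)
  TrueAt-toFormula (J T S) f = TrueAt-toFormula T f ×-⇔ TrueAt-toFormula S _
  TrueAt-toFormula (∃ᵗ T)  f {σ} = Σ-⇔ (↠-id _) (λ {a} →
    Holds-cong T (agree a) ⇔-∘ TrueAt-toFormula T (f [ l ↦ x ]))
    where
    l = pred (ar T)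
    x = fresh f l
    agree : ∀ a {i} → i < ar T → (σ [ x ↦ a ]) ((f [ l ↦ x ]) i) ≡ ((σ ∘ f) [ l ↦ a ]) i
    agree a {i} i< with i ≟ l
    ... | yes _   = update-same σ x
    -- Freshness: no remaining column is named `x`.
    ... | no  i≢l = update-other σ {x} (<⇒≢ (<-fresh f (<∧≢pred⇒<pred i< i≢l)))

  TrueAt-trivial : ∀ k σ → TrueAt (trivial k) σ
  TrueAt-trivial zero    σ = element , refl
  TrueAt-trivial (suc k) σ = TrueAt-trivial k σ , refl

  Holds-toTerm : ∀ {n} f φ {σ} → Bounded n f φ → Holds (toTerm n f φ) σ ⇔ TrueAt φ (σ ∘ f)
  Holds-toTerm f (rel R xs) {σ} f< =
    Σ-⇔ (↠-id _) (λ {v} → subst-⇔ (interp R v)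
      (trans (prefix-∘ _ (σ ∘ f) (fill 0 xs)) (cong (Vec.map (σ ∘ f)) (prefix-fill 0 xs))))
    ⇔-∘ Holds-substitute _ (rel R) (f< ∘ fill-∈ 0 xs)
  Holds-toTerm f (x ≐ y)    f< = Holds-substitute _ e (f< ∘ fill-∈ 0 (x ∷ y ∷ []))
  Holds-toTerm f (¬ᶠ φ)     f< = ¬-cong-⇔ (Holds-toTerm f φ f<)
  Holds-toTerm {n} f (φ ∧ᶠ ψ) {σ} f< = begin
    Holds (toTerm n f (φ ∧ᶠ ψ)) σ
      ≈⟨ Holds-substitute _ (J T U) (splice-id-< eqT eqU) ⟩
    (Holds T (σ ∘ splice n id id) × Holds U (σ ∘ splice n id id ∘ (ar T +_)))
      ≈⟨ Holds-cong T (λ i< → cong σ (splice-< id id (subst (_ <_) eqT i<))) ×-⇔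
         Holds-cong U (λ {i} _ → cong σ (trans (cong (λ k → splice n id id (k + i)) eqT)
                                               (splice-+ id id n i))) ⟩
    (Holds T σ × Holds U σ)
      ≈⟨ Holds-toTerm f φ (f< ∘ ∈-++⁺ˡ) ×-⇔ Holds-toTerm f ψ (f< ∘ ∈-++⁺ʳ (fv φ)) ⟩
    TrueAt (φ ∧ᶠ ψ) (σ ∘ f) ∎
    where
    T = toTerm n f φ
    U = toTerm n f ψ
    eqT : ar T ≡ n
    eqT = ar-toTerm f φ (f< ∘ ∈-++⁺ˡ)
    eqU : ar U ≡ n
    eqU = ar-toTerm f ψ (f< ∘ ∈-++⁺ʳ (fv φ))
  Holds-toTerm {n} f (∃ᶠ x φ) {σ} f< = Σ-⇔ (↠-id _) (λ {a} → begin
    Holds T (σ [ pred (ar T) ↦ a ])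
      ≡⟨ cong (λ k → Holds T (σ [ pred k ↦ a ])) (ar-toTerm _ φ (bounded-∃ φ f<)) ⟩
    Holds T (σ [ n ↦ a ])
      ≈⟨ Holds-toTerm _ φ (bounded-∃ φ f<) ⟩
    TrueAt φ ((σ [ n ↦ a ]) ∘ (f [ x ↦ n ]))
      ≈⟨ TrueAt-cong φ (agree a) ⟩
    TrueAt φ ((σ ∘ f) [ x ↦ a ])
      ∎)
    where
    T = toTerm (suc n) (f [ x ↦ n ]) φ
    agree : ∀ a {y} → y ∈ fv φ → (σ [ n ↦ a ]) ((f [ x ↦ n ]) y) ≡ ((σ ∘ f) [ x ↦ a ]) y
    agree a {y} y∈ with y ≟ x
    ... | yes _   = update-same σ n
    -- A free variable other than `x` has its column below `n`, so the update at the new column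
    -- misses it.
    ... | no  y≢x = update-other σ {n} (<⇒≢ (f< (∈-filter⁺ (λ z → ¬? (z ≟ x)) y∈ y≢x)))

  -- An unlisted variable has position `length xs`, just past the tuple, where `fill` returns the
  -- same default as `assign`.
  assign-position : ∀ xs (t : Vec Domain (length xs)) x →
                    assign 𝔄 xs t x ≡ fill element t (position xs x)
  assign-position []       []      x = refl
  assign-position (y ∷ ys) (a ∷ t) x with x ≟ y
  ... | yes _ = refl
  ... | no  _ = assign-position ys t x

  -- Trades the cast in `≈` for a total assignment, which does not mention the length of the tuple.
  ⟦⟧ᵗ-cast⇔Holds : ∀ T (h : symbolsᵗ T ⊆ vocabulary) (eq : k ≡ ar T) t →
                   ⟦_⟧ᵗ 𝔄 T h (Vec.cast eq t) ⇔ Holds T (fill element t)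
  ⟦⟧ᵗ-cast⇔Holds {k} T h eq t =
    ⟦⟧ᵗ⇔Holds T h υ ⇔-∘ subst-⇔ (⟦_⟧ᵗ 𝔄 T h)
      (trans (cong (Vec.cast eq) (sym (prefix-fill element t))) (cast-prefix eq υ))
    where υ = fill element t

  formula⇔TrueAt : ∀ φ (h : symbolsᶠ φ ⊆ vocabulary) t →
                   Sat 𝔄 φ h (assign 𝔄 (freeVars φ) t) ⇔
                   TrueAt φ (fill element t ∘ position (freeVars φ))
  formula⇔TrueAt φ h t = TrueAt-cong φ (λ {x} _ → assign-position (freeVars φ) t x)
    ⇔-∘ Sat⇔TrueAt φ h _

-- The two directions of equiexpressiveness.

term→formula : ∀ T → ∃[ φ ] Equivalent ℓ φ T
term→formula {ℓ} T = φ , equivalent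
  where
  l = ar T
  φ = toFormula T id ∧ᶠ trivial l

  fv⊆ : ∀ {i} → i ∈ fv φ → i < l
  fv⊆ i∈ with ∈-++⁻ (fv (toFormula T id)) i∈
  ... | inj₁ i∈T with j , j<l , refl ← fv-toFormula T id i∈T = j<l
  ... | inj₂ i∈l = fv-trivial⁻ l i∈l

  freeVars≡ : freeVars φ ≡ upTo l
  freeVars≡ = freeVars-upTo φ fv⊆ (∈-++⁺ʳ (fv (toFormula T id)) ∘ fv-trivial⁺)

  equivalent : Equivalent ℓ φ T
  equivalent 𝔄 hφ hT = eq , λ t → let υ = fill (Model.element 𝔄) t in begin
    Sat 𝔄 φ hφ (assign 𝔄 (freeVars φ) t)
      ≈⟨ formula⇔TrueAt 𝔄 φ hφ t ⟩
    TrueAt 𝔄 φ (υ ∘ position (freeVars φ))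
      ≈⟨ TrueAt-cong 𝔄 φ (λ {i} i∈ → cong υ (trans
           (cong (λ xs → position xs i) freeVars≡) (position-applyUpTo id id (fv⊆ i∈)))) ⟩
    TrueAt 𝔄 φ υ
      ≈⟨ mk⇔ proj₁ (_, TrueAt-trivial 𝔄 l υ) ⟩
    TrueAt 𝔄 (toFormula T id) υ
      ≈⟨ TrueAt-toFormula 𝔄 T id ⟩
    Holds 𝔄 T υ
      ≈⟨ ⟦⟧ᵗ-cast⇔Holds 𝔄 T hT eq t ⟨
    ⟦_⟧ᵗ 𝔄 T hT (Vec.cast eq t)
      ∎
    where
    open import Relation.Binary.Reasoning.Setoid (⇔-setoid ℓ)
    eq : length (freeVars φ) ≡ l
    eq = trans (cong length freeVars≡) (length-upTo l)

formula→term : ∀ φ → ∃[ T ] Equivalent ℓ φ T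
formula→term φ = T , λ 𝔄 hφ hT → sym eq , λ t →
  ⇔-sym (⟦⟧ᵗ-cast⇔Holds 𝔄 T hT (sym eq) t)
    ⇔-∘ (⇔-sym (Holds-toTerm 𝔄 f φ bounded) ⇔-∘ formula⇔TrueAt 𝔄 φ hφ t)
  where
  -- Columns follow the increasing order of the free variables, as in `formulaRel`.
  f = position (freeVars φ)
  l = length (freeVars φ)
  T = toTerm l f φ
  bounded : Bounded l f φ
  bounded = position-< ∘ ∈-freeVars φ
  eq : ar T ≡ l
  eq = ar-toTerm f φ bounded

theorem3p1 : (ℓ : Level) →
    (∀ (T : Term) → ∃[ φ ] Equivalent ℓ φ T) ×
    (∀ (φ : Formula) → ∃[ T ] Equivalent ℓ φ T)
theorem3p1 ℓ = term→formula , formula→term
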